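{- Let $x$ be a hypergame. Then: - $x\triangleright 0$ iff $x$ has a non-losing strategy for L; - $x\triangleleft 0$ iff $x$ has a non-losing strategy for R; - $x\bowtie 0$ iff $x$ has a non-losing strategy for II; - $x\,\|\,0$ iff $x$ has a non-losing strategy for I.
   Context: Hypergames: work in a universe of possibly non-wellfounded sets (set theory with the Antifoundation Axiom, and the Axiom of Choice). The class $\mathcal H$ of hypergames (also called games) is the carrier of the final coalgebra $(\mathcal H,\mathrm{id})$ of the functor $F(A)=\mathcal P(A)\times\mathcal P(A)$ on the category of classes and functional classes, where $\mathcal P$ is the powerset functor. Thus a hypergame is a pair $x=(X^L,X^R)$ of sets of hypergames; elements $x^L\in X^L$ and $x^R\in X^R$ are the Left and Right options of $x$. Positions of $x$ are the hypergames hereditarily reachable from $x$. $0=(\emptyset,\emptyset)$. Relations: let $\Phi$ be the (componentwise monotone) operator on pairs of binary relations on $\mathcal H$ given by $$\Phi(\mathcal R_1,\mathcal R_2)=\big(\{(x,y)\mid \forall x^R\in X^R.\ y\,\mathcal R_2\,x^R\ \wedge\ \forall y^L\in Y^L.\ y^L\,\mathcal R_2\,x\},\ \{(x,y)\mid \exists x^R\in X^R.\ y\,\mathcal R_1\,x^R\ \vee\ \exists y^L\in Y^L.\ y^L\,\mathcal R_1\,x\}\big).$$ The pair $(\trianglerighteq,\blacktriangleright)$ is the greatest fixpoint of $\Phi$ (note that $\blacktriangleright$ need not be the complement of $\trianglerighteq$). Define: $x\triangleright y$ iff $x\trianglerighteq y$ and $y\blacktriangleright x$; $x\triangleleft y$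 iff $y\triangleright x$; $x\bowtie y$ iff $x\trianglerighteq y$ and $y\trianglerighteq x$; $x\,\|\,y$ iff $x\blacktriangleright y$ and $y\blacktriangleright x$. Plays: L (Left) and R (Right) move alternately; either may start. Player I is the one who starts, player II the other one; LI means L acting as player I, and similarly LII, RI, RII. A play on $x$ is a (possibly empty) finite or infinite sequence $x_1^{K_1}x_2^{K_2}\cdots$ with $K_i\in\{L,R\}$ and $K_{i+1}\neq K_i$, such that, with $x_0=x$ and $x_i=(X_i^L,X_i^R)$, one has $x_{i+1}\in X_i^{K_{i+1}}$ for all $i\ge 0$. A finite play is winning for L (resp. R) if it ends with a position $y=(Y^L,Y^R)$ where R (resp. L) is next to move but $Y^R=\emptyset$ (resp. $Y^L=\emptyset$); the empty play ends at $x$ with the starting player next to move. Every infinite play is a draw. A play is non-losing for L (resp. R) if it is winning for L (resp. R) or is a draw. Strategies: for P in $\{$LI, LII, RI, RII$\}$ let $\mathrm{FPlay}^P_x$ be the set of finite plays on $x$ in which P has the prescribed role (first or second player) and is next to move (the empty play is included exactly when P is LI or RI). A strategy for P on $x$ is a partial function $f$ from $\mathrm{FPlay}^P_x$ to positions of $x$ such that $f(\pi)=x'$ implies that $\pi x'$ is a play, and $f(\pi)$ is defined whenever some $\pi x'$ is a play. The opponent of LI is RII, and of LII is RI (and conversely). A play $\pi$ is coherent with $f$ if for each proper prefix $\pi'$ of $\pi$ where P is next to move, $f(\pi')=x'$ implies $\pi'x'$ is a prefix of $\pi$. For a strategy $f$ for P and a strategy $f'$ for the opponent, $f*f'$ is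 the unique maximal play coherent with both. $f$ is non-losing for P if $f*f'$ is non-losing for P (i.e. for L or R accordingly) for every strategy $f'$ of the opponent. A strategy for L is a pair of strategies for LI and LII; for R, for RI and RII; for I, for LI and RI; for II, for LII and RII. Such a pair is non-losing if both components are. -}

module Defs where

open import Axiom.ExcludedMiddle using (ExcludedMiddle)
open import Data.Empty using (⊥; ⊥-elim)
open import Data.List.Base using (List; []; _∷_; _∷ʳ_; length; applyUpTo)
open import Data.List.Properties using (applyUpTo-∷ʳ; length-applyUpTo; length-++)
open import Data.List.Relation.Binary.Pointwise.Base using (Pointwise; []; _∷_)
open import Data.List.Relation.Binary.Prefix.Heterogeneous using (Prefix; []; _∷_)
open import Data.List.Relation.Binary.Prefix.Heterogeneous.Properties as Prefixₚ using (toPointwise; length-mono)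
open import Data.Nat.Base using (ℕ; zero; suc; _≤_)
open import Data.Nat.Properties using (1+n≰n; +-comm)
open import Data.Product.Base using (Σ-syntax; ∃-syntax; _×_; _,_; proj₁; proj₂)
open import Data.Sum.Base using (_⊎_; inj₁; inj₂)
open import Data.Unit.Base using (⊤; tt)
open import Function.Bundles using (Func)
open import Level as Level using (Level; Lift; 0ℓ; _⊔_)
open import Relation.Binary.Bundles using (Setoid)
open import Relation.Binary.Core using (Rel; REL; _⇒_)
open import Relation.Binary.Definitions using (Reflexive; Symmetric; Transitive; _Respectsˡ_; _Respectsʳ_)
open import Relation.Binary.PropositionalEquality.Core using (_≡_; refl; trans; cong; subst; subst₂)
open import Relation.Nullary.Decidable.Core using (Dec; yes; no)
open import Relation.Nullary.Negation.Core using (¬_)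

1ℓ 2ℓ : Level
1ℓ = Level.suc 0ℓ
2ℓ = Level.suc 1ℓ

-- Sets with their equality are setoids, so the set-theoretic axiom of choice
-- asks for a choice function that respects the equalities.  It is needed for
-- small carriers only (a = 0ℓ): equality of hypergames lives in Set₁, and the
-- relations ⊵ and ▶ live in Set₂.

AxiomOfChoice : ∀ a e r → Set (Level.suc (a ⊔ e ⊔ r))
AxiomOfChoice a e r =
  (A B : Setoid a e) (R : REL (Setoid.Carrier A) (Setoid.Carrier B) r) →
  R Respectsˡ Setoid._≈_ A → R Respectsʳ Setoid._≈_ B →
  (∀ a → ∃[ b ] R a b) → Σ[ f ∈ Func A B ] (∀ a → R a (Func.to f a))

data Player : Set where
  L R : Player

opponent : Player → Player
opponent L = R
opponent R = L

-- Sets are the types in Set and classes the types in Set₁.  Under Antifoundation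
-- a non-wellfounded set is a small pointed graph up to bisimilarity; with edges
-- labelled L and R, pointed graphs up to _≈_ form the final coalgebra of
-- A ↦ 𝒫 A × 𝒫 A on classes.  Hence _≈_ plays the role of equality of hypergames.

record Hypergame : Set₁ where
  field
    Node : Set
    Edge : Player → Rel Node 0ℓ
    root : Node

open Hypergame public

record IsBisimulation (x y : Hypergame) (B : REL (Node x) (Node y) 0ℓ) : Set where
  field
    forth : ∀ K {m n m′} → B m n → Edge x K m m′ → ∃[ n′ ] Edge y K n n′ × B m′ n′
    back  : ∀ K {m n n′} → B m n → Edge y K n n′ → ∃[ m′ ] Edge x K m m′ × B m′ n′

infix 4 _≈_ _∈[_]_

_≈_ : Rel Hypergame 1ℓ
x ≈ y = Σ[ B ∈ REL (Node x) (Node y) 0ℓ ] IsBisimulation x y B × B (root x) (root y)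

infix 8 _at_

_at_ : (x : Hypergame) → Node x → Hypergame
x at n = record { Node = Node x ; Edge = Edge x ; root = n }

-- y ∈[ K ] x is y ∈ X^K, where x = (X^L , X^R).

_∈[_]_ : Hypergame → Player → Hypergame → Set₁
y ∈[ K ] x = ∃[ n ] Edge x K (root x) n × y ≈ x at n

𝟘 : Hypergame
𝟘 = record { Node = ⊤ ; Edge = λ _ _ _ → ⊥ ; root = tt }

≈-refl : Reflexive _≈_
≈-refl = _≡_ , record
  { forth = λ { K refl e → _ , e , refl } ; back = λ { K refl e → _ , e , refl } } , refl

≈-sym : Symmetric _≈_
≈-sym (B , b , r) = (λ n m → B m n) , record { forth = λ K → back K ; back = λ K → forth K } , r
  where open IsBisimulation b

≈-trans : Transitive _≈_
≈-trans {x} {y} {z} (B , b , r) (C , c , s) =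
  D , record { forth = fwd ; back = bwd } , (_ , r , s)
  where
  open IsBisimulation
  D : REL (Node x) (Node z) 0ℓ
  D m o = ∃[ n ] B m n × C n o
  fwd : ∀ K {m o m′} → D m o → Edge x K m m′ → ∃[ o′ ] Edge z K o o′ × D m′ o′
  fwd K (_ , p , q) e with forth b K p e
  ... | _ , e′ , p′ with forth c K q e′
  ... | _ , e″ , q′ = _ , e″ , _ , p′ , q′
  bwd : ∀ K {m o o′} → D m o → Edge z K o o′ → ∃[ m′ ] Edge x K m m′ × D m′ o′
  bwd K (_ , p , q) e with back c K q e
  ... | _ , e′ , q′ with back b K p e′
  ... | _ , e″ , p′ = _ , e″ , _ , p′ , q′

∈-resp : ∀ {x x′ y y′} K → x ≈ x′ → y ≈ y′ → y ∈[ K ] x → y′ ∈[ K ] x′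
∈-resp {x} {x′} K (B , b , r) q (n , e , p) with IsBisimulation.forth b K r e
... | n′ , e′ , r′ = n′ , e′ , ≈-trans (≈-sym q) (≈-trans p n≈n′)
  where
  n≈n′ : x at n ≈ x′ at n′
  n≈n′ = B , record { forth = λ K → forth b K ; back = λ K → back b K } , r′
    where open IsBisimulation

Φ₁ Φ₂ : ∀ {ℓ} → Rel Hypergame ℓ → Rel Hypergame (1ℓ ⊔ ℓ)
Φ₁ R₂ x y = (∀ {xᴿ} → xᴿ ∈[ R ] x → R₂ y xᴿ) × (∀ {yᴸ} → yᴸ ∈[ L ] y → R₂ yᴸ x)
Φ₂ R₁ x y = (∃[ xᴿ ] xᴿ ∈[ R ] x × R₁ y xᴿ) ⊎ (∃[ yᴸ ] yᴸ ∈[ L ] y × R₁ yᴸ x)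

PostFixed : ∀ {ℓ} → Rel Hypergame ℓ → Rel Hypergame ℓ → Set (1ℓ ⊔ ℓ)
PostFixed R₁ R₂ = (R₁ ⇒ Φ₁ R₂) × (R₂ ⇒ Φ₂ R₁)

infix 4 _⊵_ _▶_ _▷_ _◁_ _⋈_ _∥_

-- The greatest fixpoint of Φ (R₁ , R₂) = (Φ₁ R₂ , Φ₂ R₁), as the union of all
-- post-fixed pairs; ⊵▶-postFixed and ⊵▶-preFixed show that it is a fixpoint.

_⊵_ _▶_ : Rel Hypergame 2ℓ
x ⊵ y = Σ[ R₁ ∈ Rel Hypergame 1ℓ ] Σ[ R₂ ∈ Rel Hypergame 1ℓ ] PostFixed R₁ R₂ × R₁ x y
x ▶ y = Σ[ R₁ ∈ Rel Hypergame 1ℓ ] Σ[ R₂ ∈ Rel Hypergame 1ℓ ] PostFixed R₁ R₂ × R₂ x y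

⊵▶-postFixed : PostFixed _⊵_ _▶_
⊵▶-postFixed = to₁ , to₂
  where
  to₁ : _⊵_ ⇒ Φ₁ _▶_
  to₁ (R₁ , R₂ , p , r) = (λ i → R₁ , R₂ , p , proj₁ (proj₁ p r) i)
                        , (λ i → R₁ , R₂ , p , proj₂ (proj₁ p r) i)
  to₂ : _▶_ ⇒ Φ₂ _⊵_
  to₂ (R₁ , R₂ , p , r) with proj₂ p r
  ... | inj₁ (_ , i , q) = inj₁ (_ , i , R₁ , R₂ , p , q)
  ... | inj₂ (_ , i , q) = inj₂ (_ , i , R₁ , R₂ , p , q)

⊵▶-preFixed : (Φ₁ _▶_ ⇒ _⊵_) × (Φ₂ _⊵_ ⇒ _▶_)
⊵▶-preFixed = from₁ , from₂
  where
  from₁ : Φ₁ _▶_ ⇒ _⊵_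
  from₁ {x} {y} (h , k) = S₁ , S₂ , (post₁ , post₂) , inj₁ (refl , refl)
    where
    S₁ S₂ : Rel Hypergame 1ℓ
    S₁ u v = (u ≡ x × v ≡ y)
           ⊎ (∃[ xᴿ ] Σ[ i ∈ xᴿ ∈[ R ] x ] proj₁ (h i) u v)
           ⊎ (∃[ yᴸ ] Σ[ i ∈ yᴸ ∈[ L ] y ] proj₁ (k i) u v)
    S₂ u v = (∃[ xᴿ ] Σ[ i ∈ xᴿ ∈[ R ] x ] proj₁ (proj₂ (h i)) u v)
           ⊎ (∃[ yᴸ ] Σ[ i ∈ yᴸ ∈[ L ] y ] proj₁ (proj₂ (k i)) u v)
    post₁ : S₁ ⇒ Φ₁ S₂
    post₁ (inj₁ (refl , refl)) =
        (λ i → inj₁ (_ , i , proj₂ (proj₂ (proj₂ (h i)))))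
      , (λ i → inj₂ (_ , i , proj₂ (proj₂ (proj₂ (k i)))))
    post₁ (inj₂ (inj₁ (_ , i , r))) with proj₁ (proj₁ (proj₂ (proj₂ (h i)))) r
    ... | a , b = (λ j → inj₁ (_ , i , a j)) , (λ j → inj₁ (_ , i , b j))
    post₁ (inj₂ (inj₂ (_ , i , r))) with proj₁ (proj₁ (proj₂ (proj₂ (k i)))) r
    ... | a , b = (λ j → inj₂ (_ , i , a j)) , (λ j → inj₂ (_ , i , b j))
    post₂ : S₂ ⇒ Φ₂ S₁
    post₂ (inj₁ (_ , i , r)) with proj₂ (proj₁ (proj₂ (proj₂ (h i)))) r
    ... | inj₁ (_ , j , q) = inj₁ (_ , j , inj₂ (inj₁ (_ , i , q)))
    ... | inj₂ (_ , j , q) = inj₂ (_ , j , inj₂ (inj₁ (_ , i , q)))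
    post₂ (inj₂ (_ , i , r)) with proj₂ (proj₁ (proj₂ (proj₂ (k i)))) r
    ... | inj₁ (_ , j , q) = inj₁ (_ , j , inj₂ (inj₂ (_ , i , q)))
    ... | inj₂ (_ , j , q) = inj₂ (_ , j , inj₂ (inj₂ (_ , i , q)))
  from₂ : Φ₂ _⊵_ ⇒ _▶_
  from₂ {x} {y} (inj₁ (xᴿ , i , R₁ , R₂ , p , r)) =
    R₁ , (λ u v → R₂ u v ⊎ (u ≡ x × v ≡ y)) ,
    ( (λ s → (λ j → inj₁ (proj₁ (proj₁ p s) j)) , (λ j → inj₁ (proj₂ (proj₁ p s) j)))
    , λ { (inj₁ s) → proj₂ p s ; (inj₂ (refl , refl)) → inj₁ (xᴿ , i , r) } ) ,
    inj₂ (refl , refl)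
  from₂ {x} {y} (inj₂ (yᴸ , i , R₁ , R₂ , p , r)) =
    R₁ , (λ u v → R₂ u v ⊎ (u ≡ x × v ≡ y)) ,
    ( (λ s → (λ j → inj₁ (proj₁ (proj₁ p s) j)) , (λ j → inj₁ (proj₂ (proj₁ p s) j)))
    , λ { (inj₁ s) → proj₂ p s ; (inj₂ (refl , refl)) → inj₂ (yᴸ , i , r) } ) ,
    inj₂ (refl , refl)

_▷_ _◁_ _⋈_ _∥_ : Rel Hypergame 2ℓ
x ▷ y = x ⊵ y × y ▶ x
x ◁ y = y ▷ x
x ⋈ y = x ⊵ y × y ⊵ x
x ∥ y = x ▶ y × y ▶ x

-- A finite play x₁^{K₁} ⋯ xₙ^{Kₙ} is stored as the list x₁ ∷ ⋯ ∷ xₙ ∷ []: the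
-- labels alternate, so they are determined by the player K who starts.

data IsFinitePlay : Player → Hypergame → List Hypergame → Set₁ where
  []  : ∀ {K x} → IsFinitePlay K x []
  _∷_ : ∀ {K x y ys} → y ∈[ K ] x → IsFinitePlay (opponent K) y ys → IsFinitePlay K x (y ∷ ys)

toMove : Player → List Hypergame → Player
toMove K []       = K
toMove K (_ ∷ ys) = toMove (opponent K) ys

lastPosition : Hypergame → List Hypergame → Hypergame
lastPosition x []       = x
lastPosition x (y ∷ ys) = lastPosition y ys

data Play : Set₁ where
  finite   : List Hypergame → Play
  infinite : (ℕ → Hypergame) → Play

IsPlay : Player → Hypergame → Play → Set₁
IsPlay K x (finite π)   = IsFinitePlay K x π
IsPlay K x (infinite σ) = ∀ n → IsFinitePlay K x (applyUpTo σ n)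

Winning : (starter : Player) → Player → Hypergame → Play → Set₁
Winning S K x (finite π) =
  toMove S π ≡ opponent K × (∀ y → ¬ y ∈[ opponent K ] lastPosition x π)
Winning S K x (infinite σ) = Lift 1ℓ ⊥

Draw : Play → Set
Draw (finite π)   = ⊥
Draw (infinite σ) = ⊤

infix 4 _⊑_ _⊏_ _≼_

_⊑_ _⊏_ : List Hypergame → Play → Set₁
π ⊑ finite ρ   = Prefix _≈_ π ρ
π ⊑ infinite σ = ∃[ n ] Prefix _≈_ π (applyUpTo σ n)
π ⊏ ρ = ∃[ y ] π ∷ʳ y ⊑ ρ

_≼_ : Rel Play 1ℓ
ρ ≼ ρ′ = ∀ {π} → π ⊑ ρ → π ⊑ ρ′

record Role : Set where
  constructor role
  field
    player  : Player
    starter : Player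

  NonLosingPlay : Hypergame → Play → Set₁
  NonLosingPlay x ρ = Winning starter player x ρ ⊎ Draw ρ

  record FPlay (x : Hypergame) (π : List Hypergame) : Set₁ where
    constructor _,_
    field
      play : IsFinitePlay starter x π
      turn : toMove starter π ≡ player

open Role public

LI LII RI RII : Role
LI  = role L L
LII = role L R
RI  = role R R
RII = role R L

rival : Role → Role
rival (role K S) = role (opponent K) S

-- A partial function is given by its graph π ↦ y, which is a relation between
-- plays and hypergames and thus compatible with _≈_.  That its values are
-- positions of x follows from legal.

record Strategy (P : Role) (x : Hypergame) : Set₂ where
  infix 4 _↦_
  field
    _↦_        : List Hypergame → Hypergame → Set₁
    respects   : ∀ {π π′ y y′} → Pointwise _≈_ π π′ → y ≈ y′ → π ↦ y → π′ ↦ y′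
    functional : ∀ {π y y′} → π ↦ y → π ↦ y′ → y ≈ y′
    domain     : ∀ {π y} → π ↦ y → FPlay P x π
    legal      : ∀ {π y} → π ↦ y → IsFinitePlay (starter P) x (π ∷ʳ y)
    total      : ∀ {π y} → FPlay P x π → IsFinitePlay (starter P) x (π ∷ʳ y) → ∃[ y′ ] π ↦ y′

Coherent : ∀ {P x} → Strategy P x → Play → Set₁
Coherent f ρ = ∀ {π y} → π ⊏ ρ → π ↦ y → π ∷ʳ y ⊑ ρ
  where open Strategy f

record IsCommonPlay {P x} (f : Strategy P x) (f′ : Strategy (rival P) x) (ρ : Play) : Set₁ where
  field
    play      : IsPlay (starter P) x ρ
    coherent  : Coherent f ρ
    coherent′ : Coherent f′ ρ

-- ρ is the play f * f′.

record IsOutcome {P x} (f : Strategy P x) (f′ : Strategy (rival P) x) (ρ : Play) : Set₁ where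
  field
    common  : IsCommonPlay f f′ ρ
    maximal : ∀ {ρ′} → IsCommonPlay f f′ ρ′ → ρ ≼ ρ′ → ρ′ ≼ ρ

-- By outcome-exists and outcome-unique below, quantifying over all outcomes is
-- the same as speaking about the single play f * f′.

NonLosing : ∀ {P x} → Strategy P x → Set₂
NonLosing {P} {x} f =
  ∀ (f′ : Strategy (rival P) x) {ρ} → IsOutcome f f′ ρ → NonLosingPlay P x ρ

HasNonLosingPair : Role → Role → Hypergame → Set₂
HasNonLosingPair P Q x =
  Σ[ (f , g) ∈ Strategy P x × Strategy Q x ] NonLosing f × NonLosing g

NonLosingForL NonLosingForR NonLosingForI NonLosingForII : Hypergame → Set₂
NonLosingForL  = HasNonLosingPair LI LII
NonLosingForR  = HasNonLosingPair RI RII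
NonLosingForI  = HasNonLosingPair LI RI
NonLosingForII = HasNonLosingPair LII RII

private
  infix 4 _⊴_ _≋_
  _⊴_ _≋_ : List Hypergame → List Hypergame → Set₁
  _⊴_ = Prefix _≈_
  _≋_ = Pointwise _≈_

  ⊴-refl : ∀ {π} → π ⊴ π
  ⊴-refl {[]}    = []
  ⊴-refl {x ∷ π} = ≈-refl ∷ ⊴-refl

  ≋-refl : ∀ {π} → π ≋ π
  ≋-refl = toPointwise refl ⊴-refl

  ⊴-trans : ∀ {π τ μ} → π ⊴ τ → τ ⊴ μ → π ⊴ μ
  ⊴-trans = Prefixₚ.trans ≈-trans

  ⊴-init : ∀ π {y} → π ⊴ π ∷ʳ y
  ⊴-init []      = []
  ⊴-init (x ∷ π) = ≈-refl ∷ ⊴-init π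

  ∷ʳ-cong : ∀ π {y z} → y ≈ z → π ∷ʳ y ⊴ π ∷ʳ z
  ∷ʳ-cong []      p = p ∷ []
  ∷ʳ-cong (x ∷ π) p = ≈-refl ∷ ∷ʳ-cong π p

  ∷ʳ-last : ∀ π {y z μ} → π ∷ʳ y ⊴ μ → π ∷ʳ z ⊴ μ → y ≈ z
  ∷ʳ-last []      (p ∷ _) (q ∷ _) = ≈-trans p (≈-sym q)
  ∷ʳ-last (x ∷ π) (_ ∷ p) (_ ∷ q) = ∷ʳ-last π p q

  ∷ʳ-split : ∀ τ {w} π {y} → τ ∷ʳ w ⊴ π ∷ʳ y → τ ∷ʳ w ⊴ π ⊎ (τ ≋ π × w ≈ y)
  ∷ʳ-split []      []      (p ∷ _) = inj₂ ([] , p)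
  ∷ʳ-split []      (x ∷ π) (p ∷ _) = inj₁ (p ∷ [])
  ∷ʳ-split (t ∷ []) []     (_ ∷ ())
  ∷ʳ-split (t ∷ _ ∷ _) []  (_ ∷ ())
  ∷ʳ-split (t ∷ τ) (x ∷ π) (p ∷ q) with ∷ʳ-split τ π q
  ... | inj₁ r       = inj₁ (p ∷ r)
  ... | inj₂ (r , s) = inj₂ (p ∷ r , s)

  ∷ʳ-cong′ : ∀ {τ π y z} → τ ≋ π → y ≈ z → τ ∷ʳ y ⊴ π ∷ʳ z
  ∷ʳ-cong′ []      q = q ∷ []
  ∷ʳ-cong′ (p ∷ r) q = p ∷ ∷ʳ-cong′ r q

  proper? : ∀ {π μ} → π ⊴ μ → (∃[ w ] π ∷ʳ w ⊴ μ) ⊎ (μ ⊴ π)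
  proper? {μ = []}    []      = inj₂ []
  proper? {μ = w ∷ μ} []      = inj₁ (w , ≈-refl ∷ [])
  proper? (p ∷ r) with proper? r
  ... | inj₁ (w , s) = inj₁ (w , p ∷ s)
  ... | inj₂ s       = inj₂ (≈-sym p ∷ s)

  applyUpTo-⊴ : ∀ {σ : ℕ → Hypergame} n → applyUpTo σ n ⊴ applyUpTo σ (suc n)
  applyUpTo-⊴ zero    = []
  applyUpTo-⊴ (suc n) = ≈-refl ∷ applyUpTo-⊴ n

  comparable : ∀ {π τ μ} → π ⊴ μ → τ ⊴ μ → τ ⊴ π ⊎ (∃[ w ] π ∷ʳ w ⊴ τ)
  comparable _       []      = inj₁ []
  comparable []      (q ∷ _) = inj₂ (_ , ≈-refl ∷ [])
  comparable (p ∷ r) (q ∷ s) with comparable r s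
  ... | inj₁ u       = inj₁ (≈-trans q (≈-sym p) ∷ u)
  ... | inj₂ (w , u) = inj₂ (w , ≈-trans p (≈-sym q) ∷ u)

  ⊑-⊴ : ∀ {π τ} ρ → π ⊴ τ → τ ⊑ ρ → π ⊑ ρ
  ⊑-⊴ (finite μ)   p q       = ⊴-trans p q
  ⊑-⊴ (infinite σ) p (n , q) = n , ⊴-trans p q

  common-bound : ∀ {σ : ℕ → Hypergame} m n →
    ∃[ k ] applyUpTo σ m ⊴ applyUpTo σ k × applyUpTo σ n ⊴ applyUpTo σ k
  common-bound zero    n    = n , [] , ⊴-refl
  common-bound (suc m) zero = suc m , ⊴-refl , []
  common-bound {σ} (suc m) (suc n) with common-bound {λ i → σ (suc i)} m n
  ... | k , p , q = suc k , ≈-refl ∷ p , ≈-refl ∷ q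

  bound : ∀ {π τ} ρ → π ⊑ ρ → τ ⊑ ρ → ∃[ μ ] π ⊴ μ × τ ⊴ μ
  bound (finite μ)   p q = μ , p , q
  bound (infinite σ) (m , p) (n , q) with common-bound {σ} m n
  ... | k , r , s = _ , ⊴-trans p r , ⊴-trans q s

  ⊏-or-all : ∀ {π} ρ → π ⊑ ρ → π ⊏ ρ ⊎ (∀ {τ} → τ ⊑ ρ → τ ⊴ π)
  ⊏-or-all (finite μ) p with proper? p
  ... | inj₁ q = inj₁ q
  ... | inj₂ q = inj₂ λ r → ⊴-trans r q
  ⊏-or-all {π} (infinite σ) (n , p) with proper? (⊴-trans p (applyUpTo-⊴ {σ} n))
  ... | inj₁ (w , q) = inj₁ (w , suc n , q)
  ... | inj₂ q = ⊥-elim (1+n≰n (subst₂ _≤_ (length-applyUpTo σ (suc n)) (length-applyUpTo σ n)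
                                       (length-mono (⊴-trans q p))))

  play-resp : ∀ {K x x′ π τ} → x ≈ x′ → τ ⊴ π → IsFinitePlay K x π → IsFinitePlay K x′ τ
  play-resp p []      _       = []
  play-resp p (q ∷ r) (e ∷ h) = ∈-resp _ p (≈-sym q) e ∷ play-resp (≈-sym q) r h

  prefix-play : ∀ {K x π} ρ → IsPlay K x ρ → π ⊑ ρ → IsFinitePlay K x π
  prefix-play (finite μ)   h p       = play-resp ≈-refl p h
  prefix-play (infinite σ) h (n , p) = play-resp ≈-refl p (h n)

  turn? : ∀ K (k : Player) → k ≡ K ⊎ k ≡ opponent K
  turn? L L = inj₁ refl
  turn? L R = inj₂ refl
  turn? R L = inj₂ refl
  turn? R R = inj₁ refl

  opponent-≢ : ∀ {K k} → k ≡ K → ¬ k ≡ opponent K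
  opponent-≢ {L} refl ()
  opponent-≢ {R} refl ()

  snoc-ind : ∀ {p} (P : List Hypergame → Set p) →
             P [] → (∀ π y → P π → P (π ∷ʳ y)) → ∀ π → P π
  snoc-ind P b s []      = b
  snoc-ind P b s (x ∷ π) = snoc-ind (λ τ → P (x ∷ τ)) (s [] x b) (λ τ y → s (x ∷ τ) y) π

module _ {P x} (f : Strategy P x) (f′ : Strategy (rival P) x) where
  private
    module F  = Strategy f
    module F′ = Strategy f′
    S = starter P
    K = player P

    _▹_ : List Hypergame → Hypergame → Set₁
    π ▹ y = (π F.↦ y) ⊎ (π F′.↦ y)

    continue : ∀ {π y} → IsFinitePlay S x (π ∷ʳ y) → ∃[ z ] π ▹ z
    continue {π} h with turn? K (toMove S π)
    ... | inj₁ t with F.total (play-resp ≈-refl (⊴-init π) h , t) h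
    ... | z , e = z , inj₁ e
    continue {π} h | inj₂ t with F′.total (play-resp ≈-refl (⊴-init π) h , t) h
    ... | z , e = z , inj₂ e

    legal▹ : ∀ {π y} → π ▹ y → IsFinitePlay S x (π ∷ʳ y)
    legal▹ (inj₁ e) = F.legal e
    legal▹ (inj₂ e) = F′.legal e

    follow : ∀ {ρ} → IsCommonPlay f f′ ρ → ∀ {π z} → π ⊏ ρ → π ▹ z → π ∷ʳ z ⊑ ρ
    follow c p (inj₁ e) = IsCommonPlay.coherent c p e
    follow c p (inj₂ e) = IsCommonPlay.coherent′ c p e

    functional▹ : ∀ {τ π y z} → τ ≋ π → τ ▹ z → π ▹ y → z ≈ y
    functional▹ p (inj₁ d) (inj₁ e) = F.functional (F.respects p ≈-refl d) e
    functional▹ p (inj₁ d) (inj₂ e) =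
      ⊥-elim (opponent-≢ (FPlay.turn (F.domain (F.respects p ≈-refl d))) (FPlay.turn (F′.domain e)))
    functional▹ p (inj₂ d) (inj₁ e) =
      ⊥-elim (opponent-≢ (FPlay.turn (F.domain e)) (FPlay.turn (F′.domain (F′.respects p ≈-refl d))))
    functional▹ p (inj₂ d) (inj₂ e) = F′.functional (F′.respects p ≈-refl d) e

  outcome-≼ : ∀ {ρ ρ′} → IsOutcome f f′ ρ → IsOutcome f f′ ρ′ → ρ ≼ ρ′
  outcome-≼ {ρ} {ρ′} o o′ {π} = snoc-ind (λ π → π ⊑ ρ → π ⊑ ρ′) base step π
    where
    open IsOutcome
    base : [] ⊑ ρ → [] ⊑ ρ′
    base _ = nil ρ′ where
      nil : ∀ ρ → [] ⊑ ρ
      nil (finite μ)   = []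
      nil (infinite σ) = 0 , []
    step : ∀ π y → (π ⊑ ρ → π ⊑ ρ′) → π ∷ʳ y ⊑ ρ → π ∷ʳ y ⊑ ρ′
    step π y ih p with ⊏-or-all ρ′ (ih (⊑-⊴ ρ (⊴-init π) p))
    ... | inj₂ all = maximal o′ (common o) (λ q → ⊑-⊴ ρ (all q) (⊑-⊴ ρ (⊴-init π) p)) p
    ... | inj₁ lt with continue (prefix-play ρ (IsCommonPlay.play (common o)) p)
    ... | z , e with bound ρ p (follow (common o) (y , p) e)
    ... | μ , q , r = ⊑-⊴ ρ′ (∷ʳ-cong π (∷ʳ-last π q r)) (follow (common o′) lt e)

  outcome-unique : ∀ {ρ ρ′} → IsOutcome f f′ ρ → IsOutcome f f′ ρ′ → ρ ≼ ρ′ × ρ′ ≼ ρ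
  outcome-unique o o′ = outcome-≼ o o′ , outcome-≼ o′ o

  module _ (em : ExcludedMiddle 1ℓ) where
    private
      Followed : List Hypergame → Set₁
      Followed π = IsFinitePlay S x π × (∀ {τ w z} → τ ∷ʳ w ⊴ π → τ ▹ z → τ ∷ʳ z ⊴ π)

      extend : ∀ {π y} → Followed π → π ▹ y → Followed (π ∷ʳ y)
      extend {π} {y} (h , c) e = legal▹ e , ext
        where
        ext : ∀ {τ w z} → τ ∷ʳ w ⊴ π ∷ʳ y → τ ▹ z → τ ∷ʳ z ⊴ π ∷ʳ y
        ext {τ} p d with ∷ʳ-split τ π p
        ... | inj₁ q       = ⊴-trans (c q d) (⊴-init π)
        ... | inj₂ (q , _) = ∷ʳ-cong′ q (functional▹ q d e)

      common-finite : ∀ {π} → Followed π → IsCommonPlay f f′ (finite π)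
      common-finite (h , c) = record
        { play      = h
        ; coherent  = λ (_ , p) e → c p (inj₁ e)
        ; coherent′ = λ (_ , p) e → c p (inj₂ e) }

      next : ∀ {π} → Dec (∃[ y ] π ▹ y) → Hypergame
      next (yes (y , _)) = y
      next (no _)        = 𝟘

      move : List Hypergame → Hypergame
      move π = next {π} em

      move-▹ : ∀ {π} (d : Dec (∃[ y ] π ▹ y)) → (∃[ y ] π ▹ y) → π ▹ next d
      move-▹ (yes (_ , e)) _ = e
      move-▹ (no n)        e = ⊥-elim (n e)

      run : ℕ → List Hypergame
      run zero    = []
      run (suc n) = run n ∷ʳ move (run n)

      followed₀ : Followed []
      followed₀ = [] , λ { {[]} () ; {_ ∷ _} () }

      stuck-outcome : ∀ {π} → Followed π → ¬ (∃[ y ] π ▹ y) → IsOutcome f f′ (finite π)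
      stuck-outcome {π} h stuck = record { common = common-finite h ; maximal = max }
        where
        max : ∀ {ρ′} → IsCommonPlay f f′ ρ′ → finite π ≼ ρ′ → ρ′ ≼ finite π
        max {ρ′} c le q with ⊏-or-all ρ′ (le ⊴-refl)
        ... | inj₂ all    = all q
        ... | inj₁ (w , p) = ⊥-elim (stuck (continue (prefix-play ρ′ (IsCommonPlay.play c) p)))

      search : ∀ n → (∃[ ρ ] IsOutcome f f′ ρ) ⊎ Followed (run n)
      search zero    = inj₂ followed₀
      search (suc n) with search n
      ... | inj₁ o = inj₁ o
      ... | inj₂ h = grow em
        where
        grow : Dec (∃[ y ] run n ▹ y) → (∃[ ρ ] IsOutcome f f′ ρ) ⊎ Followed (run (suc n))
        grow (no stuck) = inj₁ (_ , stuck-outcome h stuck)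
        grow (yes e)    = inj₂ (extend h (move-▹ em e))

      σ : ℕ → Hypergame
      σ n = move (run n)

      run-σ : ∀ n → run n ≡ applyUpTo σ n
      run-σ zero    = refl
      run-σ (suc n) = trans (cong (_∷ʳ σ n) (run-σ n)) (applyUpTo-∷ʳ σ n)

      infinite-outcome : (∀ n → Followed (run n)) → IsOutcome f f′ (infinite σ)
      infinite-outcome h = record
        { common  = record
          { play      = λ n → proj₁ (h′ n)
          ; coherent  = λ (_ , n , p) e → n , proj₂ (h′ n) p (inj₁ e)
          ; coherent′ = λ (_ , n , p) e → n , proj₂ (h′ n) p (inj₂ e) }
        ; maximal = λ {ρ′} → max {ρ′} }
        where
        h′ : ∀ n → Followed (applyUpTo σ n)
        h′ n = subst Followed (run-σ n) (h n)
        max : ∀ {ρ′} → IsCommonPlay f f′ ρ′ → infinite σ ≼ ρ′ → ρ′ ≼ infinite σ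
        max {ρ′} c le {τ} q with bound ρ′ (le (length τ , ⊴-refl)) q
        ... | μ , r , s with comparable r s
        ... | inj₁ u       = length τ , u
        ... | inj₂ (w , u) = ⊥-elim (1+n≰n (subst (_≤ length τ) eq (length-mono u)))
          where
          eq : length (applyUpTo σ (length τ) ∷ʳ w) ≡ suc (length τ)
          eq = trans (length-++ (applyUpTo σ (length τ)))
                 (trans (+-comm _ 1) (cong suc (length-applyUpTo σ (length τ))))

      decided : Dec (∃[ ρ ] IsOutcome f f′ ρ) → ∃[ ρ ] IsOutcome f f′ ρ
      decided (yes o) = o
      decided (no n)  = infinite σ , infinite-outcome go
        where
        go : ∀ n → Followed (run n)
        go k with search k
        ... | inj₁ o = ⊥-elim (n o)
        ... | inj₂ h = h

    outcome-exists : ∃[ ρ ] IsOutcome f f′ ρ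
    outcome-exists = decided em

{-# OPTIONS --safe #-}
module Submission where

-- Fix a player K.  Since 𝟘 has no options, the four relations between x and 𝟘
-- unfold to a single pair of mutually coinductive predicates: K is safe at x
-- with K to move if some K-option of x is safe with the opponent to move, and
-- K is safe at x with the opponent to move if every option for the opponent is
-- safe with K to move (Safe, safe-next, safe-any, safe-coind).  The four claims
-- are conjunctions of instances of one equivalence: K is safe at x with S to
-- move iff K has a non-losing strategy on x when S starts.
--
-- If K is safe, the axiom of choice on the nodes of x, up to bisimilarity,
-- gives a function that sends each position with a K-option to a K-option,
-- safe whenever that is possible (choose-options).  Playing by it keeps K safe
-- along every coherent play, so K always has a move when it is K's turn; hence
-- a finite outcome ends with the opponent unable to move, and every other
-- outcome is a draw (safe⇒nonLosing).
--
-- Conversely, let f be a non-losing strategy for K.  The final positions of the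
-- finite plays coherent with f are safe, by coinduction.  The only point to
-- check is that K has an option at the end of such a play π if K is to move.
-- Otherwise let the opponent replay π for as long as possible, and move by a
-- choice function elsewhere: then π is the outcome of f against this strategy,
-- but it is lost for K (nonLosing⇒safe).

open import Axiom.ExcludedMiddle using (ExcludedMiddle)
open import Data.Empty using (⊥; ⊥-elim)
open import Data.List.Base using (List; []; _∷_; _∷ʳ_)
open import Data.List.Relation.Binary.Pointwise using (Pointwise; []; _∷_)
import Data.List.Relation.Binary.Pointwise as Pointwiseₚ
open import Data.List.Relation.Binary.Prefix.Heterogeneous using (Prefix; []; _∷_)
open import Data.List.Relation.Binary.Prefix.Heterogeneous.Properties as Prefixₚ
  using (fromPointwise)
open import Data.List.Reverse using (Reverse; []; _∶_∶ʳ_; reverseView)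
open import Data.Nat.Base using (suc)
open import Data.Product using (Σ-syntax; ∃-syntax; _×_; _,_; proj₁; proj₂; swap)
open import Data.Sum.Base using (_⊎_; inj₁; inj₂)
open import Data.Unit.Base using (tt)
open import Function.Base using (_∘_)
open import Function.Bundles using (_⇔_; mk⇔; Func)
open import Function.Properties.Equivalence using () renaming (trans to ⇔-trans)
open import Level using (0ℓ; lift; lower)
open import Relation.Binary.Bundles using (Setoid)
open import Relation.Binary.PropositionalEquality.Core
  using (_≡_; refl; sym; trans; cong; subst; subst₂)
open import Relation.Nullary.Decidable.Core using (Dec; yes; no; map′)
open import Relation.Nullary.Negation.Core using (¬_)
open import Defs

-- Safe positions

-- Safe K t x says that K need not lose on x when t is next to move.

Safe : Player → Player → Hypergame → Set₂
Safe L L x = 𝟘 ▶ x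
Safe L R x = x ⊵ 𝟘
Safe R R x = x ▶ 𝟘
Safe R L x = 𝟘 ⊵ x

safe-any : ∀ K {x y} → Safe K (opponent K) x → y ∈[ opponent K ] x → Safe K K y
safe-any L s i = proj₁ (proj₁ ⊵▶-postFixed s) i
safe-any R s i = proj₂ (proj₁ ⊵▶-postFixed s) i

safe-next : ∀ K {x} → Safe K K x → ∃[ y ] y ∈[ K ] x × Safe K (opponent K) y
safe-next L s with proj₂ ⊵▶-postFixed s
... | inj₁ (_ , (_ , () , _) , _)
... | inj₂ r = r
safe-next R s with proj₂ ⊵▶-postFixed s
... | inj₁ r = r
... | inj₂ (_ , (_ , () , _) , _)

safe-any⁻ : ∀ K {x} → (∀ {y} → y ∈[ opponent K ] x → Safe K K y) → Safe K (opponent K) x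
safe-any⁻ L h = proj₁ ⊵▶-preFixed (h , λ { (_ , () , _) })
safe-any⁻ R h = proj₁ ⊵▶-preFixed ((λ { (_ , () , _) }) , h)

safe-next⁻ : ∀ K {x} → (∃[ y ] y ∈[ K ] x × Safe K (opponent K) y) → Safe K K x
safe-next⁻ L r = proj₂ ⊵▶-preFixed (inj₂ r)
safe-next⁻ R r = proj₂ ⊵▶-preFixed (inj₁ r)

safe-resp-next : ∀ K {x x′} → x ≈ x′ → Safe K K x → Safe K K x′
safe-resp-next K p s with safe-next K s
... | y , i , s′ = safe-next⁻ K (y , ∈-resp K p ≈-refl i , s′)

safe-resp-any : ∀ K {x x′} → x ≈ x′ → Safe K (opponent K) x → Safe K (opponent K) x′
safe-resp-any K p s =
  safe-any⁻ K λ i → safe-any K s (∈-resp (opponent K) (≈-sym p) ≈-refl i)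

-- Safe K is the greatest predicate on positions with a player to move that is
-- closed under the two unfolding rules.

safe-coind : ∀ K (P : Player → Hypergame → Set₁) →
  (∀ {x y} → P (opponent K) x → y ∈[ opponent K ] x → P K y) →
  (∀ {x} → P K x → ∃[ y ] y ∈[ K ] x × P (opponent K) y) →
  ∀ t {x} → P t x → Safe K t x
safe-coind L P any next = go
  where
  R₁ R₂ : Hypergame → Hypergame → Set₁
  R₁ u v = P R u × v ≡ 𝟘
  R₂ v u = P L u × v ≡ 𝟘
  post : PostFixed R₁ R₂
  post = (λ { (p , refl) → (λ i → any p i , refl) , λ { (_ , () , _) } })
       , (λ { (p , refl) → let (y , i , q) = next p in inj₂ (y , i , q , refl) })
  go : ∀ t {x} → P t x → Safe L t x
  go L p = R₁ , R₂ , post , p , refl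
  go R p = R₁ , R₂ , post , p , refl
safe-coind R P any next = go
  where
  R₁ R₂ : Hypergame → Hypergame → Set₁
  R₁ v u = P L u × v ≡ 𝟘
  R₂ u v = P R u × v ≡ 𝟘
  post : PostFixed R₁ R₂
  post = (λ { (p , refl) → (λ { (_ , () , _) }) , λ i → any p i , refl })
       , (λ { (p , refl) → let (y , i , q) = next p in inj₁ (y , i , q , refl) })
  go : ∀ t {x} → P t x → Safe R t x
  go L p = R₁ , R₂ , post , p , refl
  go R p = R₁ , R₂ , post , p , refl

-- Players

opponent-involutive : ∀ K → opponent (opponent K) ≡ K
opponent-involutive L = refl
opponent-involutive R = refl

turn? : ∀ K t → t ≡ K ⊎ t ≡ opponent K
turn? L L = inj₁ refl
turn? L R = inj₂ refl
turn? R L = inj₂ refl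
turn? R R = inj₁ refl

≢-opponent : ∀ {K} → ¬ K ≡ opponent K
≢-opponent {L} ()
≢-opponent {R} ()

-- Finite plays up to bisimilarity

infix 4 _⊴_ _≋_

_⊴_ _≋_ : List Hypergame → List Hypergame → Set₁
_⊴_ = Prefix _≈_
_≋_ = Pointwise _≈_

≋-refl : ∀ {π} → π ≋ π
≋-refl = Pointwiseₚ.refl ≈-refl

≋-sym : ∀ {π τ} → π ≋ τ → τ ≋ π
≋-sym = Pointwiseₚ.symmetric ≈-sym

⊴-refl : ∀ {π} → π ⊴ π
⊴-refl = fromPointwise ≋-refl

⊴-trans : ∀ {π τ μ} → π ⊴ τ → τ ⊴ μ → π ⊴ μ
⊴-trans = Prefixₚ.trans ≈-trans

∷ʳ-cong : ∀ {π τ y z} → π ≋ τ → y ≈ z → π ∷ʳ y ≋ τ ∷ʳ z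
∷ʳ-cong []      q = q ∷ []
∷ʳ-cong (p ∷ r) q = p ∷ ∷ʳ-cong r q

⊴-∷ʳ : ∀ π {y} → π ⊴ π ∷ʳ y
⊴-∷ʳ []      = []
⊴-∷ʳ (x ∷ π) = ≈-refl ∷ ⊴-∷ʳ π

∷ʳ-⋬ : ∀ π {y} → ¬ π ∷ʳ y ⊴ π
∷ʳ-⋬ (x ∷ π) (_ ∷ p) = ∷ʳ-⋬ π p

∷ʳ-last : ∀ π {y z μ} → π ∷ʳ y ⊴ μ → π ∷ʳ z ⊴ μ → y ≈ z
∷ʳ-last []      (p ∷ _) (q ∷ _) = ≈-trans p (≈-sym q)
∷ʳ-last (x ∷ π) (_ ∷ p) (_ ∷ q) = ∷ʳ-last π p q

⊴-∷ʳ⁻ : ∀ τ {w} π {y} → τ ∷ʳ w ⊴ π ∷ʳ y → τ ∷ʳ w ⊴ π ⊎ τ ≋ π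
⊴-∷ʳ⁻ []          []      _       = inj₂ []
⊴-∷ʳ⁻ []          (x ∷ π) (p ∷ _) = inj₁ (p ∷ [])
⊴-∷ʳ⁻ (t ∷ [])    []      (_ ∷ ())
⊴-∷ʳ⁻ (t ∷ _ ∷ _) []      (_ ∷ ())
⊴-∷ʳ⁻ (t ∷ τ)     (x ∷ π) (p ∷ q) with ⊴-∷ʳ⁻ τ π q
... | inj₁ r = inj₁ (p ∷ r)
... | inj₂ r = inj₂ (p ∷ r)

-- A prefix π of ρ either bounds all prefixes of ρ or can be extended in ρ.

⊑-compare : ∀ π τ ρ → π ⊑ ρ → τ ⊑ ρ → τ ⊴ π ⊎ π ⊏ ρ
⊑-compare π       []      ρ                _ _ = inj₁ []
⊑-compare []      (t ∷ τ) (finite (_ ∷ μ)) _ (q ∷ _) = inj₂ (_ , q ∷ [])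
⊑-compare []      (t ∷ τ) (infinite σ)     _ (suc n , q ∷ _) = inj₂ (_ , 1 , q ∷ [])
⊑-compare (_ ∷ π) (t ∷ τ) (finite (_ ∷ μ)) (p ∷ r) (q ∷ s)
  with ⊑-compare π τ (finite μ) r s
... | inj₁ u       = inj₁ (≈-trans q (≈-sym p) ∷ u)
... | inj₂ (w , u) = inj₂ (w , p ∷ u)
⊑-compare (_ ∷ π) (t ∷ τ) (infinite σ) (suc m , p ∷ r) (suc n , q ∷ s)
  with ⊑-compare π τ (infinite (σ ∘ suc)) (m , r) (n , s)
... | inj₁ u           = inj₁ (≈-trans q (≈-sym p) ∷ u)
... | inj₂ (w , k , u) = inj₂ (w , suc k , p ∷ u)

toMove-cong : ∀ K {π τ} → π ≋ τ → toMove K π ≡ toMove K τ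
toMove-cong K []      = refl
toMove-cong K (_ ∷ r) = toMove-cong (opponent K) r

toMove-∷ʳ : ∀ K π {y} → toMove K (π ∷ʳ y) ≡ opponent (toMove K π)
toMove-∷ʳ K []      = refl
toMove-∷ʳ K (_ ∷ π) = toMove-∷ʳ (opponent K) π

lastPosition-cong : ∀ {x x′ π τ} → x ≈ x′ → π ≋ τ → lastPosition x π ≈ lastPosition x′ τ
lastPosition-cong p []      = p
lastPosition-cong p (q ∷ r) = lastPosition-cong q r

lastPosition-∷ʳ : ∀ x π {y} → lastPosition x (π ∷ʳ y) ≡ y
lastPosition-∷ʳ x []      = refl
lastPosition-∷ʳ x (z ∷ π) = lastPosition-∷ʳ z π

play-resp : ∀ {K x x′ π τ} → x ≈ x′ → τ ⊴ π → IsFinitePlay K x π → IsFinitePlay K x′ τ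
play-resp p []      _       = []
play-resp p (q ∷ r) (i ∷ h) = ∈-resp _ p (≈-sym q) i ∷ play-resp (≈-sym q) r h

play-prefix : ∀ {K x π} ρ → IsPlay K x ρ → π ⊑ ρ → IsFinitePlay K x π
play-prefix (finite μ)   h p       = play-resp ≈-refl p h
play-prefix (infinite σ) h (n , p) = play-resp ≈-refl p (h n)

play-∷ʳ : ∀ {K x π y} → IsFinitePlay K x π → y ∈[ toMove K π ] lastPosition x π →
          IsFinitePlay K x (π ∷ʳ y)
play-∷ʳ []      i = i ∷ []
play-∷ʳ (j ∷ h) i = j ∷ play-∷ʳ h i

play-init : ∀ {K x} π {y} → IsFinitePlay K x (π ∷ʳ y) → IsFinitePlay K x π
play-init π = play-resp ≈-refl (⊴-∷ʳ π)

play-last : ∀ {K x} π {y} → IsFinitePlay K x (π ∷ʳ y) → y ∈[ toMove K π ] lastPosition x π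
play-last []      (i ∷ _) = i
play-last (_ ∷ π) (_ ∷ h) = play-last π h

-- The positions of x are represented by the nodes of x.

position : ∀ {K x π} → IsFinitePlay K x π → ∃[ n ] lastPosition x π ≈ x at n
position {x = x} h = go h (root x , ≈-refl)
  where
  go : ∀ {K y π} → IsFinitePlay K y π → ∃[ n ] y ≈ x at n → ∃[ n ] lastPosition y π ≈ x at n
  go []      p       = p
  go (i ∷ h) (m , p) with ∈-resp _ p ≈-refl i
  ... | n , _ , q = go h (n , q)

-- Coherent plays and outcomes

module _ {P x} (f : Strategy P x) where
  open Strategy f

  -- A coherent play stays coherent when extended by z, unless f prescribes
  -- another move than z.

  coherent-∷ʳ : ∀ {π z} → Coherent f (finite π) → (∀ {y} → π ↦ y → y ≈ z) →
                Coherent f (finite (π ∷ʳ z))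
  coherent-∷ʳ {π} c same {τ} (w , p) d with ⊴-∷ʳ⁻ τ π p
  ... | inj₁ q = ⊴-trans (c (w , q) d) (⊴-∷ʳ π)
  ... | inj₂ q = fromPointwise (∷ʳ-cong q (same (respects q ≈-refl d)))

  coherent-own : ∀ {π z} → Coherent f (finite π) → π ↦ z → Coherent f (finite (π ∷ʳ z))
  coherent-own c e = coherent-∷ʳ c λ d → functional d e

  coherent-other : ∀ {π z} → Coherent f (finite π) → toMove (starter P) π ≡ opponent (player P) →
                   Coherent f (finite (π ∷ʳ z))
  coherent-other c t = coherent-∷ʳ c λ d →
    ⊥-elim (≢-opponent (trans (sym (FPlay.turn (domain d))) t))

-- After the play π on x, started by S, the player next to move has no option.

Stuck : Player → Hypergame → List Hypergame → Set₁
Stuck S x π = ∀ {y} → ¬ y ∈[ toMove S π ] lastPosition x π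

module _ {P x} {f : Strategy P x} {f′ : Strategy (rival P) x} {π : List Hypergame} where
  private
    S = starter P
    K = player P
    module F  = Strategy f
    module F′ = Strategy f′

  stuck⇒outcome : IsCommonPlay f f′ (finite π) → Stuck S x π → IsOutcome f f′ (finite π)
  stuck⇒outcome c stuck = record { common = c ; maximal = λ {ρ} → max {ρ} }
    where
    max : ∀ {ρ} → IsCommonPlay f f′ ρ → finite π ≼ ρ → ρ ≼ finite π
    max {ρ} c′ le q with ⊑-compare π _ ρ (le ⊴-refl) q
    ... | inj₁ r       = r
    ... | inj₂ (w , r) = ⊥-elim (stuck (play-last π (play-prefix ρ (IsCommonPlay.play c′) r)))

  outcome⇒stuck : IsOutcome f f′ (finite π) → Stuck S x π
  outcome⇒stuck o i = contradict (turn? K (toMove S π))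
    where
    open IsOutcome o
    open IsCommonPlay common
    extension = play-∷ʳ play i
    too-long : ∀ {z} → ¬ IsCommonPlay f f′ (finite (π ∷ʳ z))
    too-long c = ∷ʳ-⋬ π (maximal c (λ p → ⊴-trans p (⊴-∷ʳ π)) ⊴-refl)
    contradict : toMove S π ≡ K ⊎ toMove S π ≡ opponent K → ⊥
    contradict (inj₁ t) with F.total (play , t) extension
    ... | z , e = too-long record
      { play      = F.legal e
      ; coherent  = coherent-own f coherent e
      ; coherent′ = coherent-other f′ coherent′ (trans t (sym (opponent-involutive K))) }
    contradict (inj₂ t) with F′.total (play , t) extension
    ... | z , e = too-long record
      { play      = F′.legal e
      ; coherent  = coherent-other f coherent t
      ; coherent′ = coherent-own f′ coherent′ e }

module _ (em : ExcludedMiddle 2ℓ) (ac : AxiomOfChoice 0ℓ 1ℓ 2ℓ) where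

  em₁ : ExcludedMiddle 1ℓ
  em₁ = map′ lower (lift {ℓ = 2ℓ}) em

  -- Choice of moves

  -- Nodes of x are equal when they stand for the same hypergame.

  nodes : Hypergame → Setoid 0ℓ 1ℓ
  nodes x = record
    { Carrier       = Node x
    ; _≈_           = λ m n → x at m ≈ x at n
    ; isEquivalence = record { refl = ≈-refl ; sym = ≈-sym ; trans = ≈-trans }
    }

  -- m is a good K-move from n: if n has any K-option, then m is one, and m is
  -- safe with the opponent to move if n is safe with K to move.

  GoodMove : Player → (x : Hypergame) → Node x → Node x → Set₂
  GoodMove K x n m = (∃[ y ] y ∈[ K ] x at n) →
    x at m ∈[ K ] x at n × (Safe K K (x at n) → Safe K (opponent K) (x at m))

  goodMove-exists : ∀ K x n → ∃[ m ] GoodMove K x n m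
  goodMove-exists K x n = by-safety em
    where
    by-option : ¬ Safe K K (x at n) → Dec (∃[ y ] y ∈[ K ] x at n) → ∃[ m ] GoodMove K x n m
    by-option ¬s (yes (y , m , e , _)) = m , λ _ → (m , e , ≈-refl) , λ s → ⊥-elim (¬s s)
    by-option ¬s (no none)             = n , λ i → ⊥-elim (none i)
    by-safety : Dec (Safe K K (x at n)) → ∃[ m ] GoodMove K x n m
    by-safety (no ¬s) = by-option ¬s em₁
    by-safety (yes s) with safe-next K s
    ... | y , (m , e , p) , s′ = m , λ _ → (m , e , ≈-refl) , λ _ → safe-resp-any K p s′

  choose-options : ∀ K x →
    Σ[ g ∈ Func (nodes x) (nodes x) ] (∀ n → GoodMove K x n (Func.to g n))
  choose-options K x = ac (nodes x) (nodes x) (GoodMove K x) respˡ respʳ (goodMove-exists K x)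
    where
    respˡ : ∀ {m n n′} → x at n ≈ x at n′ → GoodMove K x n m → GoodMove K x n′ m
    respˡ p h (y , i) with h (y , ∈-resp K (≈-sym p) ≈-refl i)
    ... | j , s = ∈-resp K p ≈-refl j , λ s′ → s (safe-resp-next K (≈-sym p) s′)
    respʳ : ∀ {n m m′} → x at m ≈ x at m′ → GoodMove K x n m → GoodMove K x n m′
    respʳ p h i with h i
    ... | j , s = ∈-resp K ≈-refl p j , λ s′ → safe-resp-any K p (s s′)

  -- The strategy that replays the play μ for as long as possible, and otherwise
  -- moves by the chosen options.  If μ is empty, it depends on the last
  -- position only.

  module Replay (P : Role) (x : Hypergame) (μ : List Hypergame)
                (μ-play : IsFinitePlay (starter P) x μ) where
    private
      K = player P
      S = starter P

    choice : Node x → Node x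
    choice = Func.to (proj₁ (choose-options K x))

    Selected : List Hypergame → Hypergame → Set₁
    Selected π y = π ∷ʳ y ⊴ μ
      ⊎ ¬ π ⊏ finite μ × (∃[ n ] lastPosition x π ≈ x at n × y ≈ x at choice n)

    private
      selected-resp : ∀ {π π′ y y′} → π ≋ π′ → y ≈ y′ → Selected π y → Selected π′ y′
      selected-resp r p (inj₁ q) =
        inj₁ (⊴-trans (fromPointwise (∷ʳ-cong (≋-sym r) (≈-sym p))) q)
      selected-resp r p (inj₂ (off , n , a , b)) =
        inj₂ ( (λ (w , q) → off (w , ⊴-trans (fromPointwise (∷ʳ-cong r ≈-refl)) q))
             , n , ≈-trans (lastPosition-cong ≈-refl (≋-sym r)) a , ≈-trans (≈-sym p) b )

      selected-functional : ∀ {π y y′} → Selected π y → Selected π y′ → y ≈ y′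
      selected-functional {π} (inj₁ p) (inj₁ q) = ∷ʳ-last π p q
      selected-functional (inj₁ p) (inj₂ (off , _)) = ⊥-elim (off (_ , p))
      selected-functional (inj₂ (off , _)) (inj₁ q) = ⊥-elim (off (_ , q))
      selected-functional (inj₂ (_ , m , a , b)) (inj₂ (_ , n , c , d)) =
        ≈-trans b (≈-trans (Func.cong (proj₁ (choose-options K x)) (≈-trans (≈-sym a) c)) (≈-sym d))

      selected-total : ∀ {π y} → FPlay P x π → IsFinitePlay S x (π ∷ʳ y) →
        Dec (π ⊏ finite μ) → ∃[ z ] IsFinitePlay S x (π ∷ʳ z) × Selected π z
      selected-total _ _ (yes (w , p)) = w , play-resp ≈-refl p μ-play , inj₁ p
      selected-total {π} (h , refl) h′ (no off) with position h
      ... | n , a = x at choice n , play-∷ʳ h (∈-resp K (≈-sym a) ≈-refl move)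
                  , inj₂ (off , n , a , ≈-refl)
        where
        move : x at choice n ∈[ K ] x at n
        move = proj₁ (proj₂ (choose-options K x) n (_ , ∈-resp K a ≈-refl (play-last π h′)))

    strategy : Strategy P x
    strategy = record
      { _↦_        = λ π y → (toMove S π ≡ K) × IsFinitePlay S x (π ∷ʳ y) × Selected π y
      ; respects   = λ r p (t , h , s) →
          trans (toMove-cong S (≋-sym r)) t
          , play-resp ≈-refl (fromPointwise (∷ʳ-cong (≋-sym r) (≈-sym p))) h
          , selected-resp r p s
      ; functional = λ {π} (_ , _ , s) (_ , _ , s′) → selected-functional {π} s s′
      ; domain     = λ {π} (t , h , _) → play-init π h , t
      ; legal      = λ (_ , h , _) → h
      ; total      = λ d h → let (z , h′ , s) = selected-total d h em₁ in
                             z , FPlay.turn d , h′ , s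
      }

    coherent : Coherent strategy (finite μ)
    coherent _   (_ , _ , inj₁ q)         = q
    coherent π⊏μ (_ , _ , inj₂ (off , _)) = ⊥-elim (off π⊏μ)

  -- From safety to strategies

  safe⇒nonLosing : ∀ K S {x} → Safe K S x → Σ[ f ∈ Strategy (role K S) x ] NonLosing f
  safe⇒nonLosing K S {x} safe = strategy , nonLosing
    where
    open Replay (role K S) x [] [] using (strategy)
    open Strategy strategy

    SafeAt : List Hypergame → Set₂
    SafeAt π = Safe K (toMove S π) (lastPosition x π)

    chosen-safe : ∀ {π z} → Safe K K (lastPosition x π) → π ↦ z → Safe K (opponent K) z
    chosen-safe {π} s (_ , _ , inj₁ q) = ⊥-elim (∷ʳ-⋬ π (⊴-trans q []))
    chosen-safe {π} s (refl , h , inj₂ (_ , n , a , b)) =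
      safe-resp-any K (≈-sym b)
        (proj₂ (proj₂ (choose-options K x) n (_ , ∈-resp K a ≈-refl (play-last π h)))
               (safe-resp-next K a s))

    module _ {μ} (h : IsFinitePlay S x μ) (c : Coherent strategy (finite μ)) where

      safe-∷ʳ : ∀ π {w} → π ∷ʳ w ⊴ μ → SafeAt π → Safe K (opponent (toMove S π)) w
      safe-∷ʳ π {w} p = by-turn _ refl
        where
        h′ : IsFinitePlay S x (π ∷ʳ w)
        h′ = play-resp ≈-refl p h
        by-turn : ∀ t → toMove S π ≡ t → Safe K t (lastPosition x π) → Safe K (opponent t) w
        by-turn t eq s with turn? K t
        ... | inj₁ refl with total (play-init π h′ , eq) h′
        ...   | z , e = safe-resp-any K (∷ʳ-last π (c (w , p) e) p) (chosen-safe {π} s e)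
        by-turn t eq s | inj₂ refl =
          subst (λ t → Safe K t w) (sym (opponent-involutive K))
            (safe-any K s (subst (λ t → w ∈[ t ] lastPosition x π) eq (play-last π h′)))

      safe-prefix : ∀ {π} → Reverse π → π ⊴ μ → SafeAt π
      safe-prefix []            _ = safe
      safe-prefix (π ∶ r ∶ʳ w) p =
        subst₂ (Safe K) (sym (toMove-∷ʳ S π)) (sym (lastPosition-∷ʳ x π))
          (safe-∷ʳ π p (safe-prefix r (⊴-trans (⊴-∷ʳ π) p)))

    nonLosing : NonLosing strategy
    nonLosing f′ {infinite σ} o = inj₂ tt
    nonLosing f′ {finite π}   o with turn? K (toMove S π)
    ... | inj₂ t = inj₁ (t , λ y i → outcome⇒stuck o (subst (λ t → y ∈[ t ] _) (sym t) i))
    ... | inj₁ t with safe-next K (subst (λ t → Safe K t _) t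
                        (safe-prefix (IsCommonPlay.play common) (IsCommonPlay.coherent common)
                                     (reverseView π) ⊴-refl))
      where open IsOutcome o
    ...   | y , i , _ = ⊥-elim (outcome⇒stuck o (subst (λ t → y ∈[ t ] _) (sym t) i))

  -- From strategies to safety

  nonLosing⇒safe : ∀ K S {x} (f : Strategy (role K S) x) → NonLosing f → Safe K S x
  nonLosing⇒safe K S {x} f nonLosing =
    safe-coind K Reached any next S
      ([] , [] , (λ {π} (_ , q) → ⊥-elim (∷ʳ-⋬ π (⊴-trans q []))) , refl , refl)
    where
    open Strategy f

    -- Reached t y says that y ends a finite play coherent with f, with t to move.

    Reached : Player → Hypergame → Set₁
    Reached t y = ∃[ π ] IsFinitePlay S x π × Coherent f (finite π) ×
                  toMove S π ≡ t × lastPosition x π ≡ y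

    -- Otherwise π would be an outcome of f that is lost for K.

    not-stuck : ∀ {π} → IsFinitePlay S x π → Coherent f (finite π) → toMove S π ≡ K →
                ¬ Stuck S x π
    not-stuck {π} h c t stuck with nonLosing strategy (stuck⇒outcome common stuck)
      where
      open Replay (rival (role K S)) x π h
      common : IsCommonPlay f strategy (finite π)
      common = record { play = h ; coherent = c ; coherent′ = coherent }
    ... | inj₁ (t′ , _) = ≢-opponent (trans (sym t) t′)

    any : ∀ {y z} → Reached (opponent K) y → z ∈[ opponent K ] y → Reached K z
    any (π , h , c , t , refl) i =
      π ∷ʳ _ , play-∷ʳ h (subst (λ t → _ ∈[ t ] _) (sym t) i) , coherent-other f c t
      , trans (toMove-∷ʳ S π) (trans (cong opponent t) (opponent-involutive K))
      , lastPosition-∷ʳ x π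

    next : ∀ {y} → Reached K y → ∃[ z ] z ∈[ K ] y × Reached (opponent K) z
    next (π , h , c , refl , refl) = decide em₁
      where
      decide : Dec (∃[ z ] z ∈[ K ] lastPosition x π) →
               ∃[ z ] z ∈[ K ] lastPosition x π × Reached (opponent K) z
      decide (no none)     = ⊥-elim (not-stuck h c refl λ i → none (_ , i))
      decide (yes (_ , i)) with total (h , refl) (play-∷ʳ h i)
      ... | z , e = z , play-last π (legal e)
                  , π ∷ʳ z , legal e , coherent-own f c e , toMove-∷ʳ S π , lastPosition-∷ʳ x π

  safeBoth⇔pair : ∀ K S K′ S′ x →
    (Safe K S x × Safe K′ S′ x) ⇔ HasNonLosingPair (role K S) (role K′ S′) x
  safeBoth⇔pair K S K′ S′ x = mk⇔
    (λ (s , t) → let (f , m) = safe⇒nonLosing K S s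
                     (g , n) = safe⇒nonLosing K′ S′ t in (f , g) , m , n)
    (λ ((f , g) , m , n) → nonLosing⇒safe K S f m , nonLosing⇒safe K′ S′ g n)

theorem2p22 : ExcludedMiddle 2ℓ → AxiomOfChoice 0ℓ 1ℓ 2ℓ → (x : Hypergame) →
    (x ▷ 𝟘 ⇔ NonLosingForL x) ×
    (x ◁ 𝟘 ⇔ NonLosingForR x) ×
    (x ⋈ 𝟘 ⇔ NonLosingForII x) ×
    (x ∥ 𝟘 ⇔ NonLosingForI x)
theorem2p22 em ac x =
    -- ▷ and ◁ put the condition for the second player first, and ∥ the one for
    -- R, while the pairs of strategies start with LI, RI and LI.
    ⇔-trans (mk⇔ swap swap) (pair L L L R x)
  , ⇔-trans (mk⇔ swap swap) (pair R R R L x)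
  , pair L R R L x
  , ⇔-trans (mk⇔ swap swap) (pair L L R R x)
  where
  pair = safeBoth⇔pair em ac
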